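{- Let $n\ge 1$. Any data structure that, for every array $A[1,n]$ of totally ordered objects, supports $\mathtt{PSV}_A$- and $\mathtt{NSV}_A$-queries on $A$ without accessing $A$ (i.e. from whose stored bits alone all the values $\mathtt{PSV}_A(i)$ and $\mathtt{NSV}_A(i)$, $1\le i\le n$, can be determined) needs at least $\lg \mathcal{S}_n$ bits in the worst case over all such arrays $A$.
   Context: $\lg$ is the binary logarithm. $A[1,n]$ is an array of elements of a totally ordered set; by convention $A[0]=A[n+1]=-\infty$ are artificial overall minima, strictly smaller than all $A[1],\dots,A[n]$. For $1\le i\le n$: - $\mathtt{PSV}_A(i)=\max\{j<i : A[j]<A[i]\}$; - $\mathtt{NSV}_A(i)=\min\{j>i : A[j]<A[i]\}$. A Schröder Tree is a rooted ordered tree in which every node except the first child in a list of siblings may be colored red or blue; first children are always colored blue, and the root is colored blue. $\mathcal{S}_n$ denotes the number of Schröder Trees on $n$ nodes (a little Schröder number). -}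

module Defs where

open import Data.Bool.Base using (Bool; true; false)
open import Data.Empty using (⊥; ⊥-elim)
open import Data.Fin.Base using (Fin; zero; suc; inject₁)
import Data.Fin.Base as Fin
open import Data.Fin.Properties using (0↔⊥; 1↔⊤; 2↔Bool; +↔⊎; *↔×)
open import Data.List.Base using (List; []; _∷_)
open import Data.Nat.Base using (ℕ; zero; suc; _+_; _*_; _≤_; z≤n; s≤s)
open import Data.Nat.Properties using (suc-injective; ≡-irrelevant; ≤-refl; ≤-trans; m≤n⇒m≤1+n)
open import Data.Product.Base using (Σ-syntax; ∃; _×_; _,_; proj₁; proj₂)
open import Data.Product.Function.NonDependent.Propositional using (_×-↔_)
open import Data.Sum.Base using (_⊎_; inj₁; inj₂)
open import Data.Sum.Function.Propositional using (_⊎-↔_)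
open import Data.Unit.Base using (⊤; tt)
open import Data.Vec.Base using (Vec; _∷_; _∷ʳ_; map; lookup)
open import Function.Bundles using (_↔_; mk↔ₛ′)
open import Function.Construct.Composition using (_↔-∘_)
open import Level using (Level; _⊔_) renaming (suc to lsuc)
open import Relation.Binary.Bundles using (StrictTotalOrder)
import Relation.Binary.Construct.Add.Infimum.Strict as AddInfimum
open import Relation.Binary.PropositionalEquality.Core using (_≡_; refl; cong)
open import Relation.Nullary.Construct.Add.Infimum using (_₋; ⊥₋; [_])

private
  variable
    p : Level
    n : ℕ

------------------------------------------------------------------------
-- Previous and next smaller values

IsMax : (Fin n → Set p) → Fin n → Set p
IsMax P m = P m × (∀ k → P k → k Fin.≤ m)

IsMin : (Fin n → Set p) → Fin n → Set p
IsMin P m = P m × (∀ k → P k → m Fin.≤ k)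

module _ {c ℓ₁ ℓ₂ : Level} (O : StrictTotalOrder c ℓ₁ ℓ₂) where

  open StrictTotalOrder O using (Carrier; _<_)
  open AddInfimum _<_ using (_<₋_)

  Array : ℕ → Set c
  Array n = Vec Carrier n

  -- The array A[0], A[1], …, A[n], A[n+1] with A[0] = A[n+1] = -∞.
  _at_ : Array n → Fin (2 + n) → Carrier ₋
  A at j = lookup (⊥₋ ∷ (map [_] A ∷ʳ ⊥₋)) j

  -- Positions 0, …, n+1 are Fin (2 + n); the query positions 1, …, n
  -- are Fin n, embedded by `position`.
  position : Fin n → Fin (2 + n)
  position i = suc (inject₁ i)

  IsPSV : Array n → Fin n → Fin (2 + n) → Set (c ⊔ ℓ₂)
  IsPSV A i = IsMax (λ j → j Fin.< position i × (A at j) <₋ (A at position i))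

  IsNSV : Array n → Fin n → Fin (2 + n) → Set (c ⊔ ℓ₂)
  IsNSV A i = IsMin (λ j → position i Fin.< j × (A at j) <₋ (A at position i))

-- The stored bit string may have a different length for each array.  The
-- queries see only that string (and n), neither the array nor its order.
record PSV-NSV-Structure (c ℓ₁ ℓ₂ : Level) (n : ℕ) : Set (lsuc (c ⊔ ℓ₁ ⊔ ℓ₂)) where
  field
    encode : (O : StrictTotalOrder c ℓ₁ ℓ₂) → Array O n → List Bool
    psv    : List Bool → Fin n → Fin (2 + n)
    nsv    : List Bool → Fin n → Fin (2 + n)
    psv-correct : ∀ O (A : Array O n) i → IsPSV O A i (psv (encode O A) i)
    nsv-correct : ∀ O (A : Array O n) i → IsNSV O A i (nsv (encode O A) i)

------------------------------------------------------------------------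
-- Schröder trees

data Colour : Set where
  red blue : Colour

-- A node has either no children, or a first child followed by a list of
-- further children.  Only the latter carry a colour, since the root and
-- all first children are always blue.
data SchröderTree : Set where
  leaf : SchröderTree
  node : SchröderTree → List (Colour × SchröderTree) → SchröderTree

mutual
  size : SchröderTree → ℕ
  size leaf        = 1
  size (node t ts) = suc (size t + sizes ts)

  sizes : List (Colour × SchröderTree) → ℕ
  sizes []             = 0
  sizes ((_ , t) ∷ ts) = size t + sizes ts

SchröderTreeOn : ℕ → Set
SchröderTreeOn n = Σ[ t ∈ SchröderTree ] size t ≡ n

SiblingsOn : ℕ → Set
SiblingsOn n = Σ[ ts ∈ List (Colour × SchröderTree) ] sizes ts ≡ n

------------------------------------------------------------------------
-- There are finitely many Schröder trees on n nodes

Finite : Set → Set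
Finite X = ∃ λ k → Fin k ↔ X

private

  transport : ∀ {X Y} → X ↔ Y → Finite X → Finite Y
  transport e (k , f) = k , (e ↔-∘ f)

  finite-⊎ : ∀ {X Y} → Finite X → Finite Y → Finite (X ⊎ Y)
  finite-⊎ (k , f) (l , g) = k + l , ((f ⊎-↔ g) ↔-∘ +↔⊎)

  finite-× : ∀ {X Y} → Finite X → Finite Y → Finite (X × Y)
  finite-× (k , f) (l , g) = k * l , ((f ×-↔ g) ↔-∘ *↔×)

  Split : ℕ → (ℕ → Set) → (ℕ → Set) → Set
  Split m X Y = Σ[ i ∈ ℕ ] Σ[ j ∈ ℕ ] i + j ≡ m × X i × Y j

  split-zero : ∀ {X Y} → (X 0 × Y 0) ↔ Split 0 X Y
  split-zero {X} {Y} = mk↔ₛ′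
    (λ { (x , y) → zero , zero , refl , x , y })
    (λ { (zero , zero , refl , x , y) → x , y })
    (λ { (zero , zero , refl , x , y) → refl })
    (λ { (x , y) → refl })

  split-suc : ∀ {X Y m} → ((X 0 × Y (suc m)) ⊎ Split m (λ i → X (suc i)) Y) ↔ Split (suc m) X Y
  split-suc = mk↔ₛ′
    (λ { (inj₁ (x , y)) → zero , _ , refl , x , y
       ; (inj₂ (i , j , refl , x , y)) → suc i , j , refl , x , y })
    (λ { (zero , _ , refl , x , y) → inj₁ (x , y)
       ; (suc i , j , refl , x , y) → inj₂ (i , j , refl , x , y) })
    (λ { (zero , _ , refl , x , y) → refl
       ; (suc i , j , refl , x , y) → refl })
    (λ { (inj₁ (x , y)) → refl
       ; (inj₂ (i , j , refl , x , y)) → refl })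

  finite-split : ∀ m {X Y} → (∀ i → i ≤ m → Finite (X i)) → (∀ j → j ≤ m → Finite (Y j)) →
                 Finite (Split m X Y)
  finite-split zero    f g = transport split-zero (finite-× (f 0 z≤n) (g 0 z≤n))
  finite-split (suc m) f g = transport split-suc
    (finite-⊎ (finite-× (f 0 z≤n) (g (suc m) ≤-refl))
              (finite-split m (λ i i≤m → f (suc i) (s≤s i≤m)) (λ j j≤m → g j (m≤n⇒m≤1+n j≤m))))

  no-empty-tree : ∀ t → size t ≡ 0 → ⊥
  no-empty-tree leaf       ()
  no-empty-tree (node _ _) ()

  -- Every tree has a node, so the first part of a split is never 0.
  split-tree : ∀ {m} → Split m (λ i → SchröderTreeOn (suc i)) SiblingsOn ↔
                       Split (suc m) SchröderTreeOn SiblingsOn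
  split-tree = mk↔ₛ′
    (λ { (i , j , refl , x , y) → suc i , j , refl , x , y })
    (λ { (zero , j , e , (t , t≡0) , y) → ⊥-elim (no-empty-tree t t≡0)
       ; (suc i , j , refl , x , y) → i , j , refl , x , y })
    (λ { (zero , j , e , (t , t≡0) , y) → ⊥-elim (no-empty-tree t t≡0)
       ; (suc i , j , refl , x , y) → refl })
    (λ { (i , j , refl , x , y) → refl })

  one-node : ⊤ ↔ SchröderTreeOn 1
  one-node = mk↔ₛ′
    (λ _ → leaf , refl)
    (λ _ → tt)
    (λ { (leaf , refl) → refl
       ; (node leaf _ , ())
       ; (node (node _ _) _ , ()) })
    (λ _ → refl)

  more-nodes : ∀ {m} → Split (suc m) SchröderTreeOn SiblingsOn ↔ SchröderTreeOn (suc (suc m))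
  more-nodes = mk↔ₛ′
    (λ { (i , j , e , (t , refl) , (ts , refl)) → node t ts , cong suc e })
    (λ { (node t ts , e) → size t , sizes ts , suc-injective e , (t , refl) , (ts , refl) })
    (λ { (node t ts , e) → cong (node t ts ,_) (≡-irrelevant _ _) })
    (λ { (i , j , e , (t , refl) , (ts , refl)) →
           cong (λ e′ → i , j , e′ , (t , refl) , (ts , refl)) (≡-irrelevant _ _) })

  no-siblings : ⊤ ↔ SiblingsOn 0
  no-siblings = mk↔ₛ′
    (λ _ → [] , refl)
    (λ _ → tt)
    (λ { ([] , refl) → refl
       ; ((_ , leaf) ∷ _ , ())
       ; ((_ , node _ _) ∷ _ , ()) })
    (λ _ → refl)

  more-siblings : ∀ {m} → (Colour × Split (suc m) SchröderTreeOn SiblingsOn) ↔ SiblingsOn (suc m)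
  more-siblings = mk↔ₛ′
    (λ { (c , i , j , e , (t , refl) , (ts , refl)) → (c , t) ∷ ts , e })
    (λ { ((c , t) ∷ ts , e) → c , size t , sizes ts , e , (t , refl) , (ts , refl) })
    (λ { ((c , t) ∷ ts , e) → refl })
    (λ { (c , i , j , e , (t , refl) , (ts , refl)) → refl })

  finite-Colour : Finite Colour
  finite-Colour = 2 , (mk↔ₛ′ (λ { true → blue ; false → red }) (λ { blue → true ; red → false })
                             (λ { blue → refl ; red → refl }) (λ { true → refl ; false → refl })
                       ↔-∘ 2↔Bool)

  finite-upTo : ∀ n m → m ≤ n → Finite (SchröderTreeOn (suc m)) × Finite (SiblingsOn m)
  finite-upTo n       zero    _         = (1 , (one-node ↔-∘ 1↔⊤)) , (1 , (no-siblings ↔-∘ 1↔⊤))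
  finite-upTo (suc n) (suc m) (s≤s m≤n) =
    transport more-nodes splits , transport more-siblings (finite-× finite-Colour splits)
    where
    splits : Finite (Split (suc m) SchröderTreeOn SiblingsOn)
    splits = transport split-tree (finite-split m
      (λ i i≤m → proj₁ (finite-upTo n i (≤-trans i≤m m≤n)))
      (λ j j≤m → proj₂ (finite-upTo n j (≤-trans j≤m m≤n))))

finite-SchröderTreeOn : ∀ n → Finite (SchröderTreeOn n)
finite-SchröderTreeOn zero    =
  0 , (mk↔ₛ′ (λ ()) (λ (t , e) → no-empty-tree t e) (λ (t , e) → ⊥-elim (no-empty-tree t e)) (λ ()) ↔-∘ 0↔⊥)
finite-SchröderTreeOn (suc m) = proj₁ (finite-upTo m m ≤-refl)

𝒮 : ℕ → ℕ
𝒮 n = proj₁ (finite-SchröderTreeOn n)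

𝒮-counts : ∀ n → Fin (𝒮 n) ↔ SchröderTreeOn n
𝒮-counts n = proj₂ (finite-SchröderTreeOn n)

{-# OPTIONS --safe #-}

-- Write a Schröder tree on n + 1 nodes in preorder and give its non-root nodes
-- values larger than those of their parents, siblings being non-increasing: a
-- red node equals its left sibling, a blue one is strictly smaller.  The PSVs
-- of this array of length n determine the shape of the tree (node i's subtree
-- ends at the first j with PSV(j) < i) and the NSVs its colours, so a data
-- structure assigns distinct strings to the trees on n + 1 nodes.  If n ≥ 2, a
-- leaf of either colour can be inserted after the root's first child, whence
-- there are at least 2 𝒮 n of those trees.  This factor 2 pays for the variable
-- length of the strings: only 2 ^ (b + 1) - 1 strings have at most b bits.

module Submission where

open import Defs
open import Data.Bool.Base using (Bool; true; false)
open import Data.Empty using (⊥; ⊥-elim)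
open import Data.Fin.Base using (Fin; zero; suc; toℕ; fromℕ<)
open import Data.Fin.Properties
  using (toℕ<n; toℕ-fromℕ<; toℕ-inject₁; fromℕ<-injective; injective⇒≤; any?; *↔×)
open import Data.List.Base using (List; []; _∷_; _++_; length)
open import Data.List.Properties using (length-++)
open import Data.List.Relation.Unary.All as All using (All; []; _∷_)
open import Data.List.Relation.Unary.All.Properties using (++⁺)
open import Data.Nat.Base using (ℕ; zero; suc; _+_; _*_; _^_; _≤_; _<_; z≤n; s≤s; s≤s⁻¹)
open import Data.Nat.Binary.Base as ℕᵇ using (ℕᵇ; 2[1+_]; 1+[2_])
import Data.Nat.Binary.Properties as ℕᵇ
open import Data.Nat.Properties
open import Data.Product.Base using (Σ-syntax; ∃; _×_; _,_; proj₁; proj₂)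
open import Data.Sum.Base using (inj₁; inj₂)
open import Data.Vec.Base as Vec using (Vec; []; _∷_; _∷ʳ_; lookup; fromList; replicate)
open import Function.Base using (_∘_)
open import Function.Bundles using (_↔_; module Inverse; module Injection)
open import Function.Definitions using (Injective)
open import Function.Properties.Inverse using (↔⇒↣)
open import Level using (Level; Lift; lift; lower)
open import Relation.Binary.Bundles using (StrictTotalOrder)
import Relation.Binary.Construct.Add.Infimum.Strict as AddInfimum
open import Relation.Binary.Definitions using (Tri; tri<; tri≈; tri>)
open import Relation.Binary.PropositionalEquality
open import Relation.Binary.Structures.Biased using (isStrictTotalOrderᶜ)
open import Relation.Nullary using (yes; no)
open import Relation.Nullary.Construct.Add.Infimum using (_₋; ⊥₋; [_])

private
  variable
    f g : ℕ → ℕ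
    i j p e e′ : ℕ
    xs ys : List ℕ

-- The array of a Schröder tree

bump : Colour → ℕ → ℕ
bump red  a = a
bump blue a = suc a

-- v is a strict lower bound on the shifted values (see Reads), so the last sibling
-- gets v itself; going left, each blue sibling forces an increase.
firstValue : ℕ → List (Colour × SchröderTree) → ℕ
firstValue v []             = v
firstValue v ((c , _) ∷ ts) = bump c (firstValue v ts)

mutual
  -- Here `v` is the shifted value of the root of the tree (0 for the overall root), which itself is
  -- not listed; hence the `suc` when descending.
  values : ℕ → SchröderTree → List ℕ
  values v leaf        = []
  values v (node t ts) = firstValue v ts ∷ values (suc (firstValue v ts)) t ++ valuesRest v ts

  valuesRest : ℕ → List (Colour × SchröderTree) → List ℕ
  valuesRest v []             = []
  valuesRest v ((_ , t) ∷ ts) = firstValue v ts ∷ values (suc (firstValue v ts)) t ++ valuesRest v ts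

mutual
  length-values : ∀ v t → suc (length (values v t)) ≡ size t
  length-values v leaf        = refl
  length-values v (node t ts) = cong suc (length-siblings v t ts)

  length-valuesRest : ∀ v ts → length (valuesRest v ts) ≡ sizes ts
  length-valuesRest v []             = refl
  length-valuesRest v ((_ , t) ∷ ts) = length-siblings v t ts

  length-siblings : ∀ v t ts →
    suc (length (values (suc (firstValue v ts)) t ++ valuesRest v ts)) ≡ size t + sizes ts
  length-siblings v t ts = trans (cong suc (length-++ (values (suc (firstValue v ts)) t)))
    (cong₂ _+_ (length-values (suc (firstValue v ts)) t) (length-valuesRest v ts))

bump-≥ : ∀ c a → a ≤ bump c a
bump-≥ red  a = ≤-refl
bump-≥ blue a = n≤1+n a

firstValue-≥ : ∀ v ts → v ≤ firstValue v ts
firstValue-≥ v []             = ≤-refl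
firstValue-≥ v ((c , _) ∷ ts) = ≤-trans (firstValue-≥ v ts) (bump-≥ c _)

mutual
  values-≥ : ∀ v t → All (v ≤_) (values v t)
  values-≥ v leaf        = []
  values-≥ v (node t ts) = siblings-≥ v t ts

  valuesRest-≥ : ∀ v ts → All (v ≤_) (valuesRest v ts)
  valuesRest-≥ v []             = []
  valuesRest-≥ v ((_ , t) ∷ ts) = siblings-≥ v t ts

  siblings-≥ : ∀ v t ts →
    All (v ≤_) (firstValue v ts ∷ values (suc (firstValue v ts)) t ++ valuesRest v ts)
  siblings-≥ v t ts = v≤a ∷
    ++⁺ (All.map (≤-trans (m≤n⇒m≤1+n v≤a)) (values-≥ (suc (firstValue v ts)) t)) (valuesRest-≥ v ts)
    where v≤a = firstValue-≥ v ts

-- Reading a list of values off a function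

-- Stored values are shifted by one, so that 0 is left for the sentinels -∞.
data Reads (f : ℕ → ℕ) : ℕ → List ℕ → ℕ → Set where
  []  : Reads f i [] i
  _∷_ : ∀ {x} → f i ≡ suc x → Reads f (suc i) xs e → Reads f i (x ∷ xs) e

Reads-++⁻ : ∀ xs → Reads f i (xs ++ ys) e → ∃ λ m → Reads f i xs m × Reads f m ys e
Reads-++⁻ []       r       = _ , [] , r
Reads-++⁻ (x ∷ xs) (q ∷ r) with Reads-++⁻ xs r
... | m , r₁ , r₂ = m , q ∷ r₁ , r₂

Reads-≤ : Reads f i xs e → i ≤ e
Reads-≤ []      = ≤-refl
Reads-≤ (_ ∷ r) = ≤-trans (n≤1+n _) (Reads-≤ r)

Reads-> : ∀ {v} → Reads f i xs e → All (v ≤_) xs → ∀ k → i ≤ k → k < e → v < f k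
Reads-> []      []       k i≤k k<i = ⊥-elim (<⇒≱ k<i i≤k)
Reads-> (q ∷ r) (v≤ ∷ a) k i≤k k<e with m≤n⇒m<n∨m≡n i≤k
... | inj₁ i<k  = Reads-> r a k i<k k<e
... | inj₂ refl = ≤-trans (s≤s v≤) (≤-reflexive (sym q))

-- What the queries reveal

SmallerIn : (ℕ → ℕ) → ℕ → ℕ → ℕ → Set
SmallerIn f i j x = ∃ λ k → i ≤ k × k < j × f k < f x

-- SmallerIn f i j j says i ≤ PSV(j), and SmallerIn f (suc i) j i says NSV(i) < j;
-- both are determined by the answers to the queries.
record Transfers (f g : ℕ → ℕ) : Set where
  field
    onPSV : SmallerIn f i j j → SmallerIn g i j j
    onNSV : SmallerIn f (suc i) j i → SmallerIn g (suc i) j i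
open Transfers

MinimalUpTo : (ℕ → ℕ) → ℕ → ℕ → Set
MinimalUpTo f p e = ∀ k → p ≤ k → k < e → f p ≤ f k

minimal-self : MinimalUpTo f p (suc p)
minimal-self {f} k p≤k (s≤s k≤p) = ≤-reflexive (cong f (≤-antisym p≤k k≤p))

-- An ascent puts the PSV of `e` in `g` at `p` or later; transferred to `f`, it would need a value
-- below `f p` in a stretch where `f p` is minimal.
no-ascent : Transfers g f → p < e → MinimalUpTo f p e → f e ≤ f p → g p < g e → ⊥
no-ascent tr p<e min fe≤fp gp<ge with onPSV tr (_ , ≤-refl , p<e , gp<ge)
... | k , p≤k , k<e , fk<fe = <⇒≱ fk<fe (≤-trans fe≤fp (min k p≤k k<e))

-- A descent puts the NSV of `i` in `f` at `e` or earlier, while in `g` no value from `i` through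
-- `e` is below that of `i`.
no-descent : Transfers f g → i < e → f e < f i → MinimalUpTo g i (suc e) → ⊥
no-descent tr i<e fe<fi min with onNSV tr (_ , i<e , ≤-refl , fe<fi)
... | k , i<k , k≤e , gk<gi = <⇒≱ gk<gi (min k (<⇒≤ i<k) k≤e)

-- Trees inside a function on positions

-- Here i is the root of t, and the descendants occupy positions i+1, …, e-1.
record ChildrenAt (f : ℕ → ℕ) (i : ℕ) (t : SchröderTree) (e : ℕ) : Set where
  constructor childrenAt
  field
    reads : Reads f (suc i) (values (f i) t) e
    stop  : f e ≤ f i

-- Here p is the parent, and the siblings ts start at position i and end before e.
record SiblingsAt (f : ℕ → ℕ) (p i : ℕ) (ts : List (Colour × SchröderTree)) (e : ℕ) : Set where
  constructor siblingsAt
  field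
    reads   : Reads f i (valuesRest (f p) ts) e
    stop    : f e ≤ f p
    p<i     : p < i
    minimal : MinimalUpTo f p i

-- The colour of a sibling affects only values to its left, so a first child may be read as a blue
-- sibling with nothing before it.
node-children : ∀ {t ts} → ChildrenAt f i (node t ts) e →
                SiblingsAt f i (suc i) ((blue , t) ∷ ts) e
node-children {f} (childrenAt r s) = siblingsAt r s ≤-refl (minimal-self {f})

start : ∀ {c t ts} → SiblingsAt f p i ((c , t) ∷ ts) e → f i ≡ suc (firstValue (f p) ts)
start (siblingsAt (q ∷ _) _ _ _) = q

-- The subtree of `i` ends either at the next sibling, whose value is no larger, or at `e`, where
-- the value is at most the parent's. All its entries exceed the parent's value, so `p` stays
-- minimal up to `m`.
after-first : ∀ {c t ts} → SiblingsAt f p i ((c , t) ∷ ts) e →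
              ∃ λ m → ChildrenAt f i t m × SiblingsAt f p m ts e
after-first {f} {p} {i} {e} {t = t} {ts} (siblingsAt (q ∷ r) s p<i min)
  with Reads-++⁻ (values (suc (firstValue (f p) ts)) t) r
... | m , r₁ , r₂ =
  m , childrenAt r₁′ (stop₁ ts r₂ q) , siblingsAt r₂ s (<-trans p<i (Reads-≤ r₁)) min′
  where
  r₁′ : Reads f (suc i) (values (f i) t) m
  r₁′ = subst (λ v → Reads f (suc i) (values v t) m) (sym q) r₁
  fp<fi : f p < f i
  fp<fi = ≤-trans (s≤s (firstValue-≥ (f p) ts)) (≤-reflexive (sym q))
  stop₁ : ∀ ts → Reads f m (valuesRest (f p) ts) e → f i ≡ suc (firstValue (f p) ts) → f m ≤ f i
  stop₁ []             []       q = ≤-trans s (<⇒≤ fp<fi)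
  stop₁ ((c , _) ∷ ts) (q′ ∷ _) q =
    ≤-trans (≤-reflexive q′) (≤-trans (s≤s (bump-≥ c _)) (≤-reflexive (sym q)))
  min′ : MinimalUpTo f p m
  min′ k p≤k k<m with <-cmp k i
  ... | tri< k<i _ _  = min k p≤k k<i
  ... | tri≈ _ refl _ = <⇒≤ fp<fi
  ... | tri> _ _ i<k  = <⇒≤ (<-trans fp<fi (Reads-> r₁′ (values-≥ (f i) t) k i<k k<m))

-- The queries determine the tree

minimal-siblings : ∀ {t} → ChildrenAt f i t e → f e ≡ f i → MinimalUpTo f i (suc e)
minimal-siblings {f} {i} {e} {t} (childrenAt r _) q k i≤k (s≤s k≤e)
  with m≤n⇒m<n∨m≡n i≤k | m≤n⇒m<n∨m≡n k≤e
... | inj₂ refl | _         = ≤-refl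
... | _         | inj₂ refl = ≤-reflexive (sym q)
... | inj₁ i<k  | inj₁ k<e  = <⇒≤ (Reads-> r (values-≥ (f i) t) k i<k k<e)

bump-suc : ∀ c {a m n} → n ≡ suc (bump c a) → m ≡ suc a → n ≡ bump c m
bump-suc red  refl refl = refl
bump-suc blue refl refl = refl

-- Position `e` is where the next sibling sits. If it is blue, the NSV of `i` is at most `e`; if
-- red, it lies beyond `e`, because the entries in between are descendants of `i`.
siblingColour-injective : ∀ {t} c c′ → Transfers f g → Transfers g f →
  ChildrenAt f i t e → ChildrenAt g i t e → f i ≡ bump c (f e) → g i ≡ bump c′ (g e) → c ≡ c′
siblingColour-injective red  red  _  _  _  _  _  _  = refl
siblingColour-injective blue blue _  _  _  _  _  _  = refl
siblingColour-injective blue red  fg _  _  cg qf qg = ⊥-elim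
  (no-descent fg (Reads-≤ (ChildrenAt.reads cg)) (≤-reflexive (sym qf))
    (minimal-siblings cg (sym qg)))
siblingColour-injective red  blue _  gf cf _  qf qg = ⊥-elim
  (no-descent gf (Reads-≤ (ChildrenAt.reads cf)) (≤-reflexive (sym qg))
    (minimal-siblings cf (sym qf)))

-- In `f` the entry at `i` has already dropped to at most the parent's value, whereas in `g` it is a
-- child and lies above it: an ascent from `p` to `i`.
no-extra-sibling : ∀ {c t ts} → Transfers g f →
  SiblingsAt f p i [] e → SiblingsAt g p i ((c , t) ∷ ts) e′ → ⊥
no-extra-sibling {g = g} {p = p} {ts = ts} gf (siblingsAt [] s p<i min) sg =
  no-ascent gf p<i min s (≤-trans (s≤s (firstValue-≥ (g p) ts)) (≤-reflexive (sym (start sg))))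

module _ (fg : Transfers f g) (gf : Transfers g f) where

  mutual
    -- End positions are part of the conclusion: only then do the next siblings in both trees start
    -- at a common position.
    children-injective : ∀ t t′ → ChildrenAt f i t e → ChildrenAt g i t′ e′ → t ≡ t′ × e ≡ e′
    children-injective leaf leaf (childrenAt [] _) (childrenAt [] _) = refl , refl
    children-injective leaf (node t′ ts′) (childrenAt [] s) cg =
      ⊥-elim (no-extra-sibling gf (siblingsAt [] s ≤-refl (minimal-self {f})) (node-children cg))
    children-injective (node t ts) leaf cf (childrenAt [] s) =
      ⊥-elim (no-extra-sibling fg (siblingsAt [] s ≤-refl (minimal-self {g})) (node-children cf))
    children-injective (node t ts) (node t′ ts′) cf cg
      with siblings-injective t t′ ts ts′ (node-children cf) (node-children cg)
    ... | refl , refl , refl = refl , refl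

    -- The colours of the two heads are left open, since they show only against the left neighbour;
    -- the call for that neighbour, if any, compares them.
    siblings-injective : ∀ {c c′} t t′ ts ts′ →
      SiblingsAt f p i ((c , t) ∷ ts) e → SiblingsAt g p i ((c′ , t′) ∷ ts′) e′ →
      t ≡ t′ × ts ≡ ts′ × e ≡ e′
    siblings-injective t t′ ts ts′ sf sg with after-first sf | after-first sg
    ... | _ , cf , rf | _ , cg , rg with children-injective t t′ cf cg
    siblings-injective t t [] [] sf sg
      | _ , cf , siblingsAt [] _ _ _ | _ , cg , siblingsAt [] _ _ _ | refl , refl = refl , refl , refl
    siblings-injective t t [] (_ ∷ _) sf sg
      | _ , cf , rf | _ , cg , rg | refl , refl = ⊥-elim (no-extra-sibling gf rf rg)
    siblings-injective t t (_ ∷ _) [] sf sg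
      | _ , cf , rf | _ , cg , rg | refl , refl = ⊥-elim (no-extra-sibling fg rg rf)
    siblings-injective t t ((d , u) ∷ ts) ((d′ , u′) ∷ ts′) sf sg
      | _ , cf , rf | _ , cg , rg | refl , refl
      with siblingColour-injective d d′ fg gf cf cg
             (bump-suc d (start sf) (start rf)) (bump-suc d′ (start sg) (start rg))
         | siblings-injective u u′ ts ts′ rf rg
    ... | refl | refl , refl , refl = refl , refl , refl

shift-reads : Reads (f ∘ suc) i xs e → Reads f (suc i) xs (suc e)
shift-reads []      = []
shift-reads (q ∷ r) = q ∷ shift-reads r

-- Arrays of natural numbers as functions on positions

module _ (c ℓ₁ ℓ₂ : Level) where

  -- The universe levels of the data structure are arbitrary, hence the lifted copy of the naturals.
  ℕ-order : StrictTotalOrder c ℓ₁ ℓ₂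
  ℕ-order = record
    { Carrier            = Lift c ℕ
    ; _≈_                = λ x y → Lift ℓ₁ (lower x ≡ lower y)
    ; _<_                = λ x y → Lift ℓ₂ (lower x < lower y)
    ; isStrictTotalOrder = isStrictTotalOrderᶜ record
      { isEquivalence = record
        { refl  = lift refl
        ; sym   = λ p → lift (sym (lower p))
        ; trans = λ p q → lift (trans (lower p) (lower q))
        }
      ; trans   = λ p q → lift (<-trans (lower p) (lower q))
      ; compare = λ x y → lift-tri (<-cmp (lower x) (lower y))
      }
    }
    where
    lift-tri : ∀ {a b c} {A : Set a} {B : Set b} {C : Set c} →
               Tri A B C → Tri (Lift ℓ₂ A) (Lift ℓ₁ B) (Lift ℓ₂ C)
    lift-tri (tri< a ¬b ¬c) = tri< (lift a) (¬b ∘ lower) (¬c ∘ lower)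
    lift-tri (tri≈ ¬a b ¬c) = tri≈ (¬a ∘ lower) (lift b) (¬c ∘ lower)
    lift-tri (tri> ¬a ¬b c) = tri> (¬a ∘ lower) (¬b ∘ lower) (lift c)

  open StrictTotalOrder ℕ-order using () renaming (Carrier to ℕ′; _<_ to _<′_)
  open AddInfimum _<′_ using (_<₋_; ⊥₋<[_]; [_])

  height : ℕ′ ₋ → ℕ
  height ⊥₋    = 0
  height [ x ] = suc (lower x)

  height-mono : ∀ {x y} → x <₋ y → height x < height y
  height-mono ⊥₋<[ _ ]     = s≤s z≤n
  height-mono [ lift x<y ] = s≤s x<y

  height-cancel : ∀ x y → height x < height y → x <₋ y
  height-cancel ⊥₋    [ y ] _         = ⊥₋<[ y ]
  height-cancel [ x ] [ y ] (s≤s x<y) = [ lift x<y ]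

  -- The default 0 past the end stands for the sentinel A[n+1] and makes `profile` total, so that
  -- the tree argument is free of bounds.
  nth : ∀ {n} → Vec ℕ′ n → ℕ → ℕ
  nth []      _       = 0
  nth (x ∷ A) zero    = suc (lower x)
  nth (x ∷ A) (suc k) = nth A k

  profile : ∀ {n} → Vec ℕ′ n → ℕ → ℕ
  profile A zero    = 0
  profile A (suc k) = nth A k

  height-∷ʳ : ∀ {n} (A : Vec ℕ′ n) j → height (lookup (Vec.map [_] A ∷ʳ ⊥₋) j) ≡ nth A (toℕ j)
  height-∷ʳ []      zero    = refl
  height-∷ʳ (x ∷ A) zero    = refl
  height-∷ʳ (x ∷ A) (suc j) = height-∷ʳ A j

  height-at : ∀ {n} (A : Vec ℕ′ n) j → height (_at_ ℕ-order A j) ≡ profile A (toℕ j)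
  height-at A zero    = refl
  height-at A (suc j) = height-∷ʳ A j

  nth-positive : ∀ {n} (A : Vec ℕ′ n) k → 0 < nth A k → k < n
  nth-positive (x ∷ A) zero    _ = s≤s z≤n
  nth-positive (x ∷ A) (suc k) h = s≤s (nth-positive A k h)

  toℕ-position : ∀ {n} (i : Fin n) → toℕ (position ℕ-order i) ≡ suc (toℕ i)
  toℕ-position i = cong suc (toℕ-inject₁ i)

  -- The larger side of a comparison is positive, so it is a stored entry and can be queried.
  profile-positive : ∀ {n} (A : Vec ℕ′ n) j → 0 < profile A j →
                     ∃ λ (i : Fin n) → toℕ (position ℕ-order i) ≡ j
  profile-positive A (suc k) h =
    fromℕ< k<n , trans (toℕ-position (fromℕ< k<n)) (cong suc (toℕ-fromℕ< k<n))
    where k<n = nth-positive A k h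

  profile-< : ∀ {n} (A : Vec ℕ′ n) j k →
    _at_ ℕ-order A j <₋ _at_ ℕ-order A k → profile A (toℕ j) < profile A (toℕ k)
  profile-< A j k = subst₂ _<_ (height-at A j) (height-at A k) ∘ height-mono

  at-< : ∀ {n} (A : Vec ℕ′ n) {j} j′ k → toℕ j′ ≡ j →
    profile A j < profile A (toℕ k) → _at_ ℕ-order A j′ <₋ _at_ ℕ-order A k
  at-< A j′ k refl = height-cancel _ _ ∘ subst₂ _<_ (sym (height-at A j′)) (sym (height-at A k))

  module _ {n} (A B : Vec ℕ′ n) (psv nsv : Fin n → Fin (2 + n))
    (psv-A : ∀ i → IsPSV ℕ-order A i (psv i)) (psv-B : ∀ i → IsPSV ℕ-order B i (psv i))
    (nsv-A : ∀ i → IsNSV ℕ-order A i (nsv i)) (nsv-B : ∀ i → IsNSV ℕ-order B i (nsv i)) where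

    -- The witness is the shared answer: maximality in `A` puts it at `k` or later, correctness for
    -- `B` makes its value smaller in `B`.
    transfer-psv : SmallerIn (profile A) i j j → SmallerIn (profile B) i j j
    transfer-psv {i} {j} (k , i≤k , k<j , h) with profile-positive A j (≤-<-trans z≤n h)
    ... | a , refl =
      toℕ (psv a) , ≤-trans i≤k (≤-trans (≤-reflexive (sym k′≡k)) k≤m) ,
      proj₁ (proj₁ (psv-B a)) , profile-< B (psv a) (position ℕ-order a) (proj₂ (proj₁ (psv-B a)))
      where
      k<n+2 = <-trans k<j (toℕ<n (position ℕ-order a))
      k′ = fromℕ< k<n+2
      k′≡k : toℕ k′ ≡ k
      k′≡k = toℕ-fromℕ< k<n+2
      k≤m : toℕ k′ ≤ toℕ (psv a)
      k≤m = proj₂ (psv-A a) k′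
        (subst (_< toℕ (position ℕ-order a)) (sym k′≡k) k<j , at-< A k′ (position ℕ-order a) k′≡k h)

    transfer-nsv : SmallerIn (profile A) (suc i) j i → SmallerIn (profile B) (suc i) j i
    transfer-nsv {i} (k , i<k , k<j , h) with profile-positive A i (≤-<-trans z≤n h)
    ... | a , refl =
      toℕ (nsv a) , proj₁ (proj₁ (nsv-B a)) ,
      ≤-<-trans m≤k k<j , profile-< B (nsv a) (position ℕ-order a) (proj₂ (proj₁ (nsv-B a)))
      where
      m≤k : toℕ (nsv a) ≤ k
      m≤k with k <? 2 + n
      -- Beyond the sentinel, `k` is no candidate for the query, but every answer lies before it
      -- anyway.
      ... | no  k≮ = ≤-trans (<⇒≤ (toℕ<n (nsv a))) (≮⇒≥ k≮)
      ... | yes k<n+2 = subst (toℕ (nsv a) ≤_) k′≡k (proj₂ (nsv-A a) k′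
        (subst (toℕ (position ℕ-order a) <_) (sym k′≡k) i<k , at-< A k′ (position ℕ-order a) k′≡k h))
        where
        k′ = fromℕ< k<n+2
        k′≡k : toℕ k′ ≡ k
        k′≡k = toℕ-fromℕ< k<n+2

    transfers : Transfers (profile A) (profile B)
    transfers = record { onPSV = transfer-psv ; onNSV = transfer-nsv }

  -- Distinct trees get distinct strings

  toArray : ∀ {n} (xs : List ℕ) → length xs ≡ n → Vec ℕ′ n
  toArray xs refl = Vec.map lift (fromList xs)

  nth-reads : ∀ {n} xs (q : length xs ≡ n) → Reads (nth (toArray xs q)) 0 xs n
  nth-reads []       refl = []
  nth-reads (x ∷ xs) refl = refl ∷ shift-reads (nth-reads xs refl)

  nth-end : ∀ {n} (A : Vec ℕ′ n) → nth A n ≡ 0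
  nth-end []      = refl
  nth-end (_ ∷ A) = nth-end A

  treeValues-length : ∀ {n} ((t , _) : SchröderTreeOn (suc n)) → length (values 0 t) ≡ n
  treeValues-length (t , q) = suc-injective (trans (length-values 0 t) q)

  treeArray : ∀ {n} → SchröderTreeOn (suc n) → Vec ℕ′ n
  treeArray t = toArray (values 0 (proj₁ t)) (treeValues-length t)

  -- The sentinel at position 0 plays the root, and the one at position n + 1 ends its subtree.
  treeArray-children : ∀ {n} (t : SchröderTreeOn (suc n)) →
                       ChildrenAt (profile (treeArray t)) 0 (proj₁ t) (suc n)
  treeArray-children t = childrenAt
    (shift-reads (nth-reads (values 0 (proj₁ t)) (treeValues-length t)))
    (≤-reflexive (nth-end (treeArray t)))

  module _ {n} (D : PSV-NSV-Structure c ℓ₁ ℓ₂ n) where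

    open PSV-NSV-Structure D

    treeCode : SchröderTreeOn (suc n) → List Bool
    treeCode t = encode ℕ-order (treeArray t)

    code-transfers : (A B : Vec ℕ′ n) → encode ℕ-order A ≡ encode ℕ-order B →
                     Transfers (profile A) (profile B)
    code-transfers A B q = transfers A B (psv (encode ℕ-order A)) (nsv (encode ℕ-order A))
      (psv-correct ℕ-order A)
      (λ i → subst (λ s → IsPSV ℕ-order B i (psv s i)) (sym q) (psv-correct ℕ-order B i))
      (nsv-correct ℕ-order A)
      (λ i → subst (λ s → IsNSV ℕ-order B i (nsv s i)) (sym q) (nsv-correct ℕ-order B i))

    treeCode-injective : Injective _≡_ _≡_ treeCode
    treeCode-injective {t , p} {u , q} eq
      with children-injective
             (code-transfers (treeArray (t , p)) (treeArray (u , q)) eq)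
             (code-transfers (treeArray (u , q)) (treeArray (t , p)) (sym eq))
             t u (treeArray-children (t , p)) (treeArray-children (u , q))
    ... | refl , _ = cong (t ,_) (≡-irrelevant p q)

-- Doubling the number of trees

addLeaf : ∀ {m} → Colour × SchröderTreeOn (2 + m) → SchröderTreeOn (3 + m)
addLeaf (c , node t ts , q) = node t ((c , leaf) ∷ ts) ,
  cong suc (trans (+-suc (size t) (sizes ts)) q)

addLeaf-injective : ∀ {m} → Injective _≡_ _≡_ (addLeaf {m})
addLeaf-injective {x = c , node t ts , q} {y = _ , node _ _ , q′} eq with cong proj₁ eq
... | refl = cong (λ q → c , node t ts , q) (≡-irrelevant q q′)

-- Counting bit strings

-- Bijective base-2 numeration, which is injective across strings of different lengths.
binary : List Bool → ℕᵇ
binary []           = ℕᵇ.zero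
binary (true  ∷ bs) = 2[1+ binary bs ]
binary (false ∷ bs) = 1+[2 binary bs ]

binary-injective : Injective _≡_ _≡_ binary
binary-injective {[]}         {[]}         eq   = refl
binary-injective {[]}         {true ∷ _}   ()
binary-injective {[]}         {false ∷ _}  ()
binary-injective {true ∷ _}   {true ∷ _}   eq =
  cong (true ∷_) (binary-injective (ℕᵇ.2[1+_]-injective eq))
binary-injective {false ∷ _}  {false ∷ _}  eq =
  cong (false ∷_) (binary-injective (ℕᵇ.1+[2_]-injective eq))

-- The largest numeral with L digits consists of 2s only and equals 2 ^ (L + 1) - 2. Adding 2 on the
-- left avoids subtraction and suits the step for digit 2, where 2 + 2 (1 + x) = 2 (2 + x).
binary-< : ∀ bs → 2 + ℕᵇ.toℕ (binary bs) ≤ 2 * 2 ^ length bs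
binary-< []           = ≤-refl
binary-< (true  ∷ bs) = ≤-trans (≤-reflexive (sym (*-suc 2 (1 + x)))) (*-monoʳ-≤ 2 (binary-< bs))
  where x = ℕᵇ.toℕ (binary bs)
binary-< (false ∷ bs) = ≤-trans
  (≤-trans (+-monoʳ-≤ 2 (+-monoˡ-≤ (2 * x) (n≤1+n 1)))
           (≤-reflexive (sym (trans (*-suc 2 (1 + x)) (cong (2 +_) (*-suc 2 x))))))
  (*-monoʳ-≤ 2 (binary-< bs))
  where x = ℕᵇ.toℕ (binary bs)

-- Otherwise every 2 ^ length is at most `k`, all numerals are below 2k, and 2 (k + 1) distinct ones
-- do not fit.
some-long-string : ∀ {k} (w : Fin (2 * suc k) → List Bool) → Injective _≡_ _≡_ w →
                   ∃ λ i → suc k ≤ 2 ^ length (w i)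
some-long-string {k} w w-inj with any? (λ i → suc k ≤? 2 ^ length (w i))
... | yes long = long
... | no ¬long = ⊥-elim (<⇒≱ (*-monoʳ-< 2 (n<1+n k))
  (injective⇒≤ {f = λ i → fromℕ< (short i)}
    (w-inj ∘ binary-injective ∘ ℕᵇ.toℕ-injective ∘ fromℕ<-injective _ _ _ _)))
  where
  short : ∀ i → ℕᵇ.toℕ (binary (w i)) < 2 * k
  short i = ≤-trans (n≤1+n _) (≤-trans (binary-< (w i))
    (*-monoʳ-≤ 2 (s≤s⁻¹ (≰⇒> (λ long → ¬long (i , long))))))

-- The lower bound

colour : Fin 2 → Colour
colour zero    = red
colour (suc _) = blue

colour-injective : Injective _≡_ _≡_ colour
colour-injective {zero}     {zero}     _ = refl
colour-injective {suc zero} {suc zero} _ = refl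

module _ {m k} (count : Fin k ↔ SchröderTreeOn (2 + m)) where

  doubled : Fin (2 * k) → SchröderTreeOn (3 + m)
  doubled x = let a , b = Inverse.to (*↔× {2} {k}) x in addLeaf (colour a , Inverse.to count b)

  doubled-injective : Injective _≡_ _≡_ doubled
  doubled-injective eq = Injection.injective (↔⇒↣ (*↔× {2} {k}))
    (cong₂ _,_ (colour-injective (cong proj₁ eq′))
                (Injection.injective (↔⇒↣ count) (cong proj₂ eq′)))
    where eq′ = addLeaf-injective eq

  some-long-code : ∀ {c ℓ₁ ℓ₂} (D : PSV-NSV-Structure c ℓ₁ ℓ₂ (2 + m)) →
    Σ[ O ∈ StrictTotalOrder c ℓ₁ ℓ₂ ] Σ[ A ∈ Array O (2 + m) ]
    k ≤ 2 ^ length (PSV-NSV-Structure.encode D O A)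
  some-long-code {c} {ℓ₁} {ℓ₂} D = ℕ-order c ℓ₁ ℓ₂ , go doubled doubled-injective
    where
    -- Abstracting the count allows a split on it: at zero any array will do, and otherwise the
    -- pigeonhole argument applies.
    go : ∀ {k} (w : Fin (2 * k) → SchröderTreeOn (3 + m)) → Injective _≡_ _≡_ w →
      Σ[ A ∈ Vec (Lift c ℕ) (2 + m) ]
        k ≤ 2 ^ length (PSV-NSV-Structure.encode D (ℕ-order c ℓ₁ ℓ₂) A)
    go {zero}  w w-inj = replicate _ (lift 0) , z≤n
    go {suc k} w w-inj
      with some-long-string (treeCode c ℓ₁ ℓ₂ D ∘ w) (w-inj ∘ treeCode-injective c ℓ₁ ℓ₂ D)
    ... | i , long = treeArray c ℓ₁ ℓ₂ (w i) , long

mainTheorem2 : {c ℓ₁ ℓ₂ : Level} (n : ℕ) → 1 ≤ n → (D : PSV-NSV-Structure c ℓ₁ ℓ₂ n) →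
    Σ[ O ∈ StrictTotalOrder c ℓ₁ ℓ₂ ] Σ[ A ∈ Array O n ]
    𝒮 n ≤ 2 ^ length (PSV-NSV-Structure.encode D O A)
-- Doubling fails here, as there is one tree on one node and one on two; but `𝒮 1` is 1, and every
-- power of two is at least 1.
mainTheorem2 {c} {ℓ₁} {ℓ₂} 1 _ D = ℕ-order c ℓ₁ ℓ₂ , lift 0 ∷ [] ,
  m^n>0 2 (length (PSV-NSV-Structure.encode D (ℕ-order c ℓ₁ ℓ₂) (lift 0 ∷ [])))
mainTheorem2 (suc (suc m)) _ D = some-long-code (𝒮-counts (2 + m)) D
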